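{- Let $\Gamma$ be the Sims-Gewirtz graph, the (unique) strongly regular graph with parameters $(56,10,0,2)$. Then the plus graph $\Gamma^+$ is connected.
   Context: A graph is strongly regular with parameters $(n,k,\lambda,\mu)$ if it has $n$ vertices, is $k$-regular, adjacent vertices have exactly $\lambda$ common neighbors and non-adjacent vertices have exactly $\mu$ common neighbors. For a graph $G$, its plus graph $G^+$ has one vertex $e^+$ for each edge $e$ of $G$, and $e^+f^+$ is an edge of $G^+$ if and only if $e$ and $f$ are two non-incident edges of a common 4-cycle of $G$. -}

module Defs where

open import Data.Nat using (ℕ)
open import Data.Bool using (Bool; true; false)
open import Data.Fin using (Fin; _<_)
open import Data.Fin.Subset using (Subset; _∩_; ∣_∣)
open import Data.Vec using (tabulate)
open import Data.Product using (Σ; _×_; _,_; proj₁)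
open import Data.Sum using (_⊎_)
open import Relation.Binary.PropositionalEquality using (_≡_; _≢_)
open import Relation.Binary.Construct.Closure.ReflexiveTransitive using (Star)

record Graph (n : ℕ) : Set where
  field
    adj   : Fin n → Fin n → Bool
    sym   : ∀ u v → adj u v ≡ adj v u
    irrefl : ∀ v → adj v v ≡ false

module _ {n : ℕ} (G : Graph n) where
  open Graph G

  Adj : Fin n → Fin n → Set
  Adj u v = adj u v ≡ true

  N : Fin n → Subset n
  N v = tabulate (adj v)

  degree : Fin n → ℕ
  degree v = ∣ N v ∣

  commonNeighbours : Fin n → Fin n → ℕ
  commonNeighbours u v = ∣ N u ∩ N v ∣

  IsSRG : ℕ → ℕ → ℕ → Set
  IsSRG k l m =
      (∀ v → degree v ≡ k)
    × (∀ u v → Adj u v → commonNeighbours u v ≡ l)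
    × (∀ u v → u ≢ v → adj u v ≡ false → commonNeighbours u v ≡ m)

  -- Edges of G: each unordered edge {a,b} is represented once, with a < b.
  Edge : Set
  Edge = Σ (Fin n × Fin n) λ { (a , b) → a < b × Adj a b }

  -- Plus graph adjacency: e = {a,b}, f = {c,d} are disjoint (non-incident)
  -- edges which are two edges of a common 4-cycle of G, i.e. the 4-cycle is
  -- a-b-c-d-a or a-b-d-c-a.
  PlusAdj : Edge → Edge → Set
  PlusAdj ((a , b) , _) ((c , d) , _) =
      (a ≢ c × a ≢ d × b ≢ c × b ≢ d)
    × ((Adj b c × Adj d a) ⊎ (Adj b d × Adj c a))

  PlusConnected : Set
  PlusConnected = ∀ (e f : Edge) → Star PlusAdj e f

{-# OPTIONS --safe #-}

-- Fix a vertex v and a vertex P at distance two.  Join two points a, b of the 8-set N(v) ∖ N(P) when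
-- they have a common neighbour adjacent to P.  This graph is 2-regular, and if a, b, c, d is a path
-- in it then the edges va and vd lie in one component of Γ⁺.  A triangle in it would give a cube in Γ
-- with antipodes v and P, which a count excludes: let f(u) be the number of neighbours of u in the
-- cube, x a common neighbour of v and P, and g(u) = 1 if u ~ x and 0 otherwise.  Then
-- (f − 1)(f − 2 + 2g) ≥ 0 sums to 20 over Γ, yet to 24 over the cube.  Hence the cycles have length
-- 4 or 8 (the proof needs only that 3, 6 and ≥ 9 do not occur), so va is joined in Γ⁺ to at least
-- three further edges vb with b outside N(P).  Varying P, every edge at v lies in the same component
-- as at least six of the ten edges at v; so all ten share a component, and Γ is connected.
module Submission where

open import Defs
open import Axiom.UniquenessOfIdentityProofs using (module Decidable⇒UIP)
open import Data.Bool using (Bool; true; false; if_then_else_)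
import Data.Bool.Properties as Bool
open import Data.Empty using (⊥; ⊥-elim)
open import Data.Fin using (Fin; zero; suc; _≟_; punchIn)
open import Data.Fin.Patterns using (0F; 1F; 2F; 3F)
open import Data.Fin.Properties using (punchInᵢ≢i; punchIn-injective; <-cmp; <-asym; <-irrelevant)
open import Data.Fin.Subset using (_∩_; ∣_∣)
open import Data.List as List using (List; []; _∷_; _++_; length)
import Data.List.Membership.DecPropositional as DecMembership
open import Data.List.Membership.Propositional using (find; lose)
open import Data.List.Properties using (length-++)
open import Data.List.Relation.Unary.All as All using (All; []; _∷_)
open import Data.List.Relation.Unary.All.Properties using () renaming (++⁺ to All-++⁺)
open import Data.List.Relation.Unary.AllPairs using ([]; _∷_)
open import Data.List.Relation.Unary.Any using (any?)
open import Data.List.Relation.Unary.Linked using (Linked; [-]; _∷_)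
open import Data.List.Relation.Unary.Unique.Propositional using (Unique)
open import Data.List.Relation.Unary.Unique.Propositional.Properties using (++⁺)
open import Data.Nat using (ℕ; zero; suc; _+_; _*_; _∸_; _≤_; _<_; z≤n; s≤s; z<s; s<s; _<?_)
import Data.Nat.ListAction as ListAction
open import Data.Nat.Properties hiding (_≟_; <-cmp; <-asym; <-irrelevant; _<?_; ≡-irrelevant)
open import Data.Nat.Tactic.RingSolver using (solve-∀)
open import Data.Product using (Σ; ∃; _×_; _,_; proj₁; proj₂)
open import Data.Sum using (_⊎_; inj₁; inj₂)
open import Data.Vec as Vec using (Vec; []; _∷_; tabulate)
open import Data.Vec.Relation.Unary.All using ([]; _∷_)
open import Data.Vec.Relation.Unary.AllPairs using ([]; _∷_)
open import Data.Vec.Relation.Unary.Unique.Propositional.Properties using (lookup-injective)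
open import Function using (_∘_)
open import Relation.Binary.Construct.Closure.ReflexiveTransitive using (Star; ε; _◅_; _◅◅_) renaming (reverse to Star-reverse)
open import Relation.Binary.Definitions using (DecidableEquality; tri<; tri≈; tri>)
open import Relation.Binary.PropositionalEquality
open import Relation.Nullary using (¬_; yes; no; contradiction)
open import Relation.Nullary.Decidable using (does; from-yes)

open import Algebra.Properties.Semiring.Sum +-*-semiring using (sum; sum-cong-≗; sum-replicate-zero; ∑-distrib-+; ∑-comm; *-distribˡ-sum)
open Decidable⇒UIP Bool._≟_ using (≡-irrelevant)

-- Counting

⟦_⟧ : Bool → ℕ
⟦ true ⟧  = 1
⟦ false ⟧ = 0

⟦⟧≤1 : ∀ b → ⟦ b ⟧ ≤ 1
⟦⟧≤1 true  = ≤-refl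
⟦⟧≤1 false = z≤n

∣tabulate∣ : ∀ {n} (p : Fin n → Bool) → ∣ tabulate p ∣ ≡ sum (λ u → ⟦ p u ⟧)
∣tabulate∣ {zero}  p = refl
∣tabulate∣ {suc n} p with p zero
... | true  = cong suc (∣tabulate∣ (p ∘ suc))
... | false = ∣tabulate∣ (p ∘ suc)

∣tabulate-∩∣ : ∀ {n} (p q : Fin n → Bool) →
               ∣ tabulate p ∩ tabulate q ∣ ≡ sum (λ u → ⟦ p u ⟧ * ⟦ q u ⟧)
∣tabulate-∩∣ {zero}  p q = refl
∣tabulate-∩∣ {suc n} p q with p zero | q zero
... | true  | true  = cong suc (∣tabulate-∩∣ (p ∘ suc) (q ∘ suc))
... | true  | false = ∣tabulate-∩∣ (p ∘ suc) (q ∘ suc)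
... | false | _     = ∣tabulate-∩∣ (p ∘ suc) (q ∘ suc)

sum-const : ∀ n c → sum {n} (λ _ → c) ≡ n * c
sum-const zero    c = refl
sum-const (suc n) c = cong (c +_) (sum-const n c)

sum-positive : ∀ {n} (h : Fin n → ℕ) → 0 < sum h → ∃ λ u → 0 < h u
sum-positive {suc n} h p with h zero in eq
... | suc _ = zero , subst (0 <_) (sym eq) (s≤s z≤n)
... | zero  with u , q ← sum-positive (h ∘ suc) p = suc u , q

-- Zeroing a value, instead of deleting the index, keeps `Fin n` fixed while an induction removes
-- vertices one by one.
erase : ∀ {n} → Fin n → (Fin n → ℕ) → Fin n → ℕ
erase x h u = if does (u ≟ x) then 0 else h u

erase-≢ : ∀ {n} {x u : Fin n} (h : Fin n → ℕ) → u ≢ x → erase x h u ≡ h u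
erase-≢ {x = x} {u} h u≢x with u ≟ x
... | yes u≡x = contradiction u≡x u≢x
... | no  _   = refl

sum-erase : ∀ {n} (x : Fin n) (h : Fin n → ℕ) → sum h ≡ h x + sum (erase x h)
sum-erase zero    h = refl
sum-erase (suc x) h = begin
  h zero + sum (h ∘ suc)                                  ≡⟨ cong (h zero +_) (sum-erase x (h ∘ suc)) ⟩
  h zero + (h (suc x) + sum (erase x (h ∘ suc)))          ≡⟨ x+[y+z]≡y+[x+z] (h zero) (h (suc x)) _ ⟩
  h (suc x) + (h zero + sum (erase x (h ∘ suc)))          ≡⟨⟩
  h (suc x) + (h zero + sum (λ u → erase (suc x) h (suc u))) ∎
  where
  open ≡-Reasoning
  x+[y+z]≡y+[x+z] : ∀ x y z → x + (y + z) ≡ y + (x + z)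
  x+[y+z]≡y+[x+z] = solve-∀

-- Once `h x` is split off, the rest of the list avoids `x`, so the induction continues with
-- `erase x h`.
partial-sum : ∀ {n} (h : Fin n → ℕ) {xs} → Unique xs → ListAction.sum (List.map h xs) ≤ sum h
partial-sum h []                    = z≤n
partial-sum h {x ∷ xs} (x∉xs ∷ xs!) = begin
  h x + ListAction.sum (List.map h xs)            ≡⟨ cong (h x +_) (cong-erase x∉xs) ⟩
  h x + ListAction.sum (List.map (erase x h) xs)  ≤⟨ +-monoʳ-≤ (h x) (partial-sum (erase x h) xs!) ⟩
  h x + sum (erase x h)                           ≡⟨ sum-erase x h ⟨
  sum h                                           ∎
  where
  open ≤-Reasoning
  cong-erase : ∀ {ys} → All (x ≢_) ys →
               ListAction.sum (List.map h ys) ≡ ListAction.sum (List.map (erase x h) ys)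
  cong-erase []           = refl
  cong-erase (x≢y ∷ x∉ys) = cong₂ _+_ (sym (erase-≢ h (x≢y ∘ sym))) (cong-erase x∉ys)

length≤sum : ∀ {n} (h : Fin n → ℕ) {xs} → Unique xs → All (λ x → h x ≡ 1) xs → length xs ≤ sum h
length≤sum h xs! ones = ≤-trans (≤-reflexive (sym (sum-map ones))) (partial-sum h xs!)
  where
  sum-map : ∀ {xs} → All (λ x → h x ≡ 1) xs → ListAction.sum (List.map h xs) ≡ length xs
  sum-map []         = refl
  sum-map (eq ∷ eqs) = cong₂ _+_ eq (sum-map eqs)

-- Each listed vertex accounts for at most 1 of the total, so a positive sum is left after all of
-- them are erased.
outside : ∀ {n} (h : Fin n → ℕ) → (∀ u → h u ≤ 1) → ∀ xs → length xs < sum h →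
          ∃ λ u → 0 < h u × All (_≢ u) xs
outside h h≤1 []       p with u , q ← sum-positive h p = u , q , []
outside h h≤1 (x ∷ xs) p
  with outside (erase x h) erase≤1 xs
         (+-cancelˡ-< 1 (length xs) (sum (erase x h)) (≤-trans p (≤-trans (≤-reflexive (sum-erase x h)) (+-monoˡ-≤ _ (h≤1 x)))))
  where
  erase≤1 : ∀ u → erase x h u ≤ 1
  erase≤1 u with u ≟ x
  ... | yes _ = z≤n
  ... | no  _ = h≤1 u
... | u , q , u∉xs with u ≟ x
...   | no u≢x = u , q , (u≢x ∘ sym) ∷ u∉xs

-- Triangle-free 2-regular graphs on eight vertices

-- Successive vertices of a path in the graph repeat, up to ≈, with period three; so a cycle whose
-- length is prime to 3 lies in one class.
record ShiftedOctet {A : Set} (_≈_ : A → A → Set) : Set₁ where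
  field
    S            : A → Set
    _∼_          : A → A → Set
    ∼-sym        : ∀ {a b} → a ∼ b → b ∼ a
    ∼⇒≢          : ∀ {a b} → a ∼ b → a ≢ b
    ∼⇒S          : ∀ {a b} → a ∼ b → S a
    neighbour    : ∀ {a} → S a → ∃ λ b → a ∼ b
    next         : ∀ {a b} → a ∼ b → ∃ λ c → b ∼ c × a ≢ c
    atMostTwo    : ∀ {q a b c} → q ∼ a → q ∼ b → q ∼ c → a ≢ b → a ≢ c → b ≢ c → ⊥
    triangleFree : ∀ {a b c} → a ∼ b → b ∼ c → c ∼ a → ⊥
    atMostEight  : ∀ {xs} → Unique xs → All S xs → length xs ≤ 8
    atLeastEight : ∀ {xs} → length xs < 8 → ∃ λ r → S r × All (_≢ r) xs
    shift        : ∀ {a b c d} → a ∼ b → b ∼ c → c ∼ d → a ≢ c → b ≢ d → a ≈ d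

record ThreeMore {A : Set} (S : A → Set) (_≈_ : A → A → Set) (z : A) : Set where
  constructor threeMore
  field
    {a b c} : A
    unique  : Unique (z ∷ a ∷ b ∷ c ∷ [])
    inside  : All S (a ∷ b ∷ c ∷ [])
    related : All (z ≈_) (a ∷ b ∷ c ∷ [])

ThreeMore-map : ∀ {A : Set} {S T : A → Set} {_≈_ : A → A → Set} {z} →
                (∀ {a} → S a → T a) → ThreeMore S _≈_ z → ThreeMore T _≈_ z
ThreeMore-map f (threeMore unique inside related) = threeMore unique (All.map f inside) related

module _ {A : Set} (_≟_ : DecidableEquality A) {_≈_ : A → A → Set}
         (≈-sym : ∀ {a b} → a ≈ b → b ≈ a) (≈-trans : ∀ {a b c} → a ≈ b → b ≈ c → a ≈ c)
         (O : ShiftedOctet _≈_) where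
  open ShiftedOctet O

  -- Paths are listed from the newest vertex back to the start `p`. Beyond `y`, an interior vertex
  -- already has two neighbours on the path other than `x`, so it cannot be `w`, which is adjacent
  -- to `x`.
  extend : ∀ {w x y} xs {p} → w ∼ x → w ≢ y → w ≢ p →
           Linked _∼_ (x ∷ y ∷ xs ++ p ∷ []) → Unique (x ∷ y ∷ xs ++ p ∷ []) →
           Unique (w ∷ x ∷ y ∷ xs ++ p ∷ [])
  extend {w} {x} {y} xs {p} w∼x w≢y w≢p (_ ∷ path) u@((x≢y ∷ x∉xs) ∷ y!) =
    (∼⇒≢ w∼x ∷ w≢y ∷ interior xs x≢y x∉xs path y!) ∷ u
    where
    interior : ∀ {b} ys → x ≢ b → All (x ≢_) (ys ++ p ∷ []) →
               Linked _∼_ (b ∷ ys ++ p ∷ []) → Unique (b ∷ ys ++ p ∷ []) →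
               All (w ≢_) (ys ++ p ∷ [])
    interior []           _   _          _            _ = w≢p ∷ []
    -- The case split exposes the successor of `c` on the path; in this clause it is `p`.
    interior (c ∷ [])     x≢b (x≢c ∷ x≢d ∷ x∉) (b∼c ∷ path@(c∼d ∷ _)) ((_ ∷ b≢d ∷ _) ∷ c!) =
      (λ { refl → atMostTwo w∼x (∼-sym b∼c) c∼d x≢b x≢d b≢d }) ∷ interior [] x≢c (x≢d ∷ x∉) path c!
    interior (c ∷ d ∷ ys) x≢b (x≢c ∷ x≢d ∷ x∉) (b∼c ∷ path@(c∼d ∷ _)) ((_ ∷ b≢d ∷ _) ∷ c!) =
      (λ { refl → atMostTwo w∼x (∼-sym b∼c) c∼d x≢b x≢d b≢d }) ∷ interior (d ∷ ys) x≢c (x≢d ∷ x∉) path c!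

  linked⇒S : ∀ {x y xs} → Linked _∼_ (x ∷ y ∷ xs) → All S (x ∷ y ∷ xs)
  linked⇒S (x∼y ∷ [-])          = ∼⇒S x∼y ∷ ∼⇒S (∼-sym x∼y) ∷ []
  linked⇒S (x∼y ∷ path@(_ ∷ _)) = ∼⇒S x∼y ∷ linked⇒S path

  -- An element `x` off the 6-cycle has two neighbours `y` and `z`. These are off the cycle too,
  -- since a cycle vertex has both its neighbours on the cycle. That makes nine elements.
  no-hexagon : ∀ {p q r s t u} → Linked _∼_ (u ∷ t ∷ s ∷ r ∷ q ∷ p ∷ []) →
               Unique (u ∷ t ∷ s ∷ r ∷ q ∷ p ∷ []) → u ∼ p → ⊥
  no-hexagon {p} {q} {r} {s} {t} {u} path@(ut ∷ ts ∷ sr ∷ rq ∷ qp ∷ [-])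
             u!@((_ ∷ u≢s ∷ _ ∷ u≢q ∷ _) ∷ (_ ∷ t≢r ∷ _ ∷ t≢p ∷ []) ∷ (_ ∷ s≢q ∷ _) ∷ (_ ∷ r≢p ∷ []) ∷ _) up
    with x , Sx , x∉@(u≢x ∷ t≢x ∷ s≢x ∷ r≢x ∷ q≢x ∷ p≢x ∷ []) ← atLeastEight {u ∷ t ∷ s ∷ r ∷ q ∷ p ∷ []} (from-yes (6 <? 8))
    with y , xy ← neighbour Sx
    with z , xz , y≢z ← next (∼-sym xy) =
    <⇒≱ (from-yes (8 <? 9)) (atMostEight
      ((∼⇒≢ (∼-sym xy) ∷ y≢z ∷ away xy) ∷ (∼⇒≢ xz ∷ All.map (_∘ sym) x∉) ∷ away xz ∷ u!)
      (∼⇒S (∼-sym xy) ∷ Sx ∷ ∼⇒S (∼-sym xz) ∷ linked⇒S path))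
    where
    away : ∀ {w} → x ∼ w → All (w ≢_) (u ∷ t ∷ s ∷ r ∷ q ∷ p ∷ [])
    away xw =
      (λ { refl → atMostTwo (∼-sym xw) ut up (t≢x ∘ sym) (p≢x ∘ sym) t≢p }) ∷
      (λ { refl → atMostTwo (∼-sym xw) (∼-sym ut) ts (u≢x ∘ sym) (s≢x ∘ sym) u≢s }) ∷
      (λ { refl → atMostTwo (∼-sym xw) (∼-sym ts) sr (t≢x ∘ sym) (r≢x ∘ sym) t≢r }) ∷
      (λ { refl → atMostTwo (∼-sym xw) (∼-sym sr) rq (s≢x ∘ sym) (q≢x ∘ sym) s≢q }) ∷
      (λ { refl → atMostTwo (∼-sym xw) (∼-sym rq) qp (r≢x ∘ sym) (p≢x ∘ sym) r≢p }) ∷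
      (λ { refl → atMostTwo (∼-sym xw) (∼-sym qp) (∼-sym up) (q≢x ∘ sym) (u≢x ∘ sym) (u≢q ∘ sym) }) ∷ []

  opaque
    -- By `extend`, a walk that never turns back can first revisit a vertex only at `p₀`, so it is
    -- followed until it closes. On a cycle of length L, `shift` relates indices that differ by 3
    -- modulo L.
    three-more : ∀ {p₀} → S p₀ → ThreeMore S _≈_ p₀
    three-more {p₀} Sp₀
      with p₁ , e₀₁ ← neighbour Sp₀
      with p₂ , e₁₂ , p₀≢p₂ ← next e₀₁
      with p₃ , e₂₃ , p₁≢p₃ ← next e₁₂
      with p₄ , e₃₄ , p₂≢p₄ ← next e₂₃
      with path₃ ← ∼-sym e₂₃ ∷ ∼-sym e₁₂ ∷ ∼-sym e₀₁ ∷ [-]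
      -- Closing after three steps would give a triangle.
      with u₃@((p₃≢p₂ ∷ _ ∷ p₃≢p₀ ∷ []) ∷ (p₂≢p₁ ∷ p₂≢p₀ ∷ []) ∷ (p₁≢p₀ ∷ []) ∷ _) ←
        extend [] (∼-sym e₂₃) (p₁≢p₃ ∘ sym) (λ { refl → triangleFree e₀₁ e₁₂ e₂₃ }) (∼-sym e₁₂ ∷ ∼-sym e₀₁ ∷ [-])
               ((∼⇒≢ (∼-sym e₁₂) ∷ (p₀≢p₂ ∘ sym) ∷ []) ∷ (∼⇒≢ (∼-sym e₀₁) ∷ []) ∷ [] ∷ [])
      with p₀₃ ← shift e₀₁ e₁₂ e₂₃ p₀≢p₂ p₁≢p₃
      with p₁₄ ← shift e₁₂ e₂₃ e₃₄ p₁≢p₃ p₂≢p₄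
      with p₄ ≟ p₀
    -- Length 4: the shifts used are 0 to 3, 1 to 0 and 2 to 1.
    ... | yes refl =
          threeMore {a = p₁} {p₂} {p₃}
            (((p₁≢p₀ ∘ sym) ∷ p₀≢p₂ ∷ (p₃≢p₀ ∘ sym) ∷ []) ∷ ((p₂≢p₁ ∘ sym) ∷ p₁≢p₃ ∷ []) ∷ ((p₃≢p₂ ∘ sym) ∷ []) ∷ [] ∷ [])
            (∼⇒S e₁₂ ∷ ∼⇒S e₂₃ ∷ ∼⇒S e₃₄ ∷ [])
            (≈-sym p₁₄ ∷ ≈-trans (≈-sym p₁₄) (≈-sym (shift e₂₃ e₃₄ e₀₁ p₂≢p₀ (p₁≢p₃ ∘ sym))) ∷ p₀₃ ∷ [])
    ... | no p₄≢p₀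
      with p₅ , e₄₅ , p₃≢p₅ ← next e₃₄
      with path₄ ← ∼-sym e₃₄ ∷ path₃
      with u₄@((p₄≢p₃ ∷ _ ∷ p₄≢p₁ ∷ _) ∷ _) ← extend (_ ∷ []) (∼-sym e₃₄) (p₂≢p₄ ∘ sym) p₄≢p₀ path₃ u₃
      with p₂₅ ← shift e₂₃ e₃₄ e₄₅ p₂≢p₄ p₃≢p₅
      with p₅ ≟ p₀
    -- Length 5: the shifts used are 0 to 3, 2 to 0 and 4 to 2.
    ... | yes refl =
          threeMore {a = p₂} {p₃} {p₄}
            ((p₀≢p₂ ∷ (p₃≢p₀ ∘ sym) ∷ (p₄≢p₀ ∘ sym) ∷ []) ∷ ((p₃≢p₂ ∘ sym) ∷ p₂≢p₄ ∷ []) ∷ ((p₄≢p₃ ∘ sym) ∷ []) ∷ [] ∷ [])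
            (∼⇒S e₂₃ ∷ ∼⇒S e₃₄ ∷ ∼⇒S e₄₅ ∷ [])
            (≈-sym p₂₅ ∷ p₀₃ ∷ ≈-trans (≈-sym p₂₅) (≈-sym (shift e₄₅ e₀₁ e₁₂ p₄≢p₁ p₀≢p₂)) ∷ [])
    ... | no p₅≢p₀
      with p₆ , e₅₆ , p₄≢p₆ ← next e₄₅
      with path₅ ← ∼-sym e₄₅ ∷ path₄
      with u₅@((p₅≢p₄ ∷ _ ∷ p₅≢p₂ ∷ _) ∷ _) ← extend (_ ∷ _ ∷ []) (∼-sym e₄₅) (p₃≢p₅ ∘ sym) p₅≢p₀ path₄ u₄
      with p₆ ≟ p₀
    ... | yes refl = ⊥-elim (no-hexagon path₅ u₅ e₅₆)
    ... | no p₆≢p₀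
      with p₇ , e₆₇ , p₅≢p₇ ← next e₅₆
      with path₆ ← ∼-sym e₅₆ ∷ path₅
      with u₆ ← extend (_ ∷ _ ∷ _ ∷ []) (∼-sym e₅₆) (p₄≢p₆ ∘ sym) p₆≢p₀ path₅ u₅
      with p₄₇ ← shift e₄₅ e₅₆ e₆₇ p₄≢p₆ p₅≢p₇
      with p₇ ≟ p₀
    -- Length 7: the shifts used are 0 to 3, 4 to 0 and 1 to 4.
    ... | yes refl =
          threeMore {a = p₁} {p₃} {p₄}
            (((p₁≢p₀ ∘ sym) ∷ (p₃≢p₀ ∘ sym) ∷ (p₄≢p₀ ∘ sym) ∷ []) ∷ (p₁≢p₃ ∷ (p₄≢p₁ ∘ sym) ∷ []) ∷ ((p₄≢p₃ ∘ sym) ∷ []) ∷ [] ∷ [])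
            (∼⇒S e₁₂ ∷ ∼⇒S e₃₄ ∷ ∼⇒S e₄₅ ∷ [])
            (≈-trans (≈-sym p₄₇) (≈-sym p₁₄) ∷ p₀₃ ∷ ≈-sym p₄₇ ∷ [])
    ... | no p₇≢p₀
      with p₈ , e₇₈ , p₆≢p₈ ← next e₆₇
      with path₇ ← ∼-sym e₆₇ ∷ path₆
      with u₇ ← extend (_ ∷ _ ∷ _ ∷ _ ∷ []) (∼-sym e₆₇) (p₅≢p₇ ∘ sym) p₇≢p₀ path₆ u₆
      with p₅₈ ← shift e₅₆ e₆₇ e₇₈ p₅≢p₇ p₆≢p₈
      with p₈ ≟ p₀
    -- Length 8: the shifts used are 0 to 3, 5 to 0 and 2 to 5.
    ... | yes refl =
          threeMore {a = p₂} {p₃} {p₅}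
            ((p₀≢p₂ ∷ (p₃≢p₀ ∘ sym) ∷ (p₅≢p₀ ∘ sym) ∷ []) ∷ ((p₃≢p₂ ∘ sym) ∷ (p₅≢p₂ ∘ sym) ∷ []) ∷ (p₃≢p₅ ∷ []) ∷ [] ∷ [])
            (∼⇒S e₂₃ ∷ ∼⇒S e₃₄ ∷ ∼⇒S e₅₆ ∷ [])
            (≈-trans (≈-sym p₅₈) (≈-sym p₂₅) ∷ p₀₃ ∷ ≈-sym p₅₈ ∷ [])
    ... | no p₈≢p₀ =
          ⊥-elim (<⇒≱ (from-yes (8 <? 9)) (atMostEight
            (extend (_ ∷ _ ∷ _ ∷ _ ∷ _ ∷ []) (∼-sym e₇₈) (p₆≢p₈ ∘ sym) p₈≢p₀ path₇ u₇)
            (linked⇒S (∼-sym e₇₈ ∷ path₇))))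

-- Neighbour counts in a strongly regular graph with k = 10, λ = 0, μ = 2

module SRG {n} (Γ : Graph n) (srg : IsSRG Γ 10 0 2) where
  open Graph Γ using (adj; irrefl) renaming (sym to adj-sym)

  open DecMembership (_≟_ {n}) using (_∈?_)

  V : Set
  V = Fin n

  infix 4 _~_
  _~_ : V → V → Set
  _~_ = Adj Γ

  ~-sym : ∀ {a b} → a ~ b → b ~ a
  ~-sym {a} {b} = trans (adj-sym b a)

  ~⇒≢ : ∀ {a b} → a ~ b → a ≢ b
  ~⇒≢ {a} a~a refl with () ← trans (sym a~a) (irrefl a)

  ≁⇒false : ∀ {a b} → ¬ a ~ b → adj a b ≡ false
  ≁⇒false = Bool.¬-not

  χ : V → V → ℕ
  χ a u = ⟦ adj a u ⟧

  χ-~ : ∀ {a b} → a ~ b → χ a b ≡ 1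
  χ-~ = cong ⟦_⟧

  χ-≁ : ∀ {a b} → ¬ a ~ b → χ a b ≡ 0
  χ-≁ = cong ⟦_⟧ ∘ ≁⇒false

  χ>0 : ∀ {a u} → 0 < χ a u → a ~ u
  χ>0 {a} {u} p with adj a u
  ... | true = refl

  common : V → V → V → ℕ
  common a b u = χ a u * χ b u

  common≤1 : ∀ a b u → common a b u ≤ 1
  common≤1 a b u = *-mono-≤ (⟦⟧≤1 (adj a u)) (⟦⟧≤1 (adj b u))

  common-~ : ∀ {a b u} → a ~ u → b ~ u → common a b u ≡ 1
  common-~ a~u b~u = cong₂ _*_ (χ-~ a~u) (χ-~ b~u)

  common>0 : ∀ {a b u} → 0 < common a b u → a ~ u × b ~ u
  common>0 {a} {b} {u} p with adj a u | adj b u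
  ... | true | true = refl , refl

  sum-χ : ∀ a → sum (χ a) ≡ 10
  sum-χ a = trans (sym (∣tabulate∣ (adj a))) (proj₁ srg a)

  sum-common-self : ∀ a → sum (common a a) ≡ 10
  sum-common-self a = trans (sum-cong-≗ (λ u → idem (adj a u))) (sum-χ a)
    where
    idem : ∀ b → ⟦ b ⟧ * ⟦ b ⟧ ≡ ⟦ b ⟧
    idem true  = refl
    idem false = refl

  sum-common-~ : ∀ {a b} → a ~ b → sum (common a b) ≡ 0
  sum-common-~ {a} {b} a~b = trans (sym (∣tabulate-∩∣ (adj a) (adj b))) (proj₁ (proj₂ srg) a b a~b)

  sum-common-≁ : ∀ {a b} → a ≢ b → ¬ a ~ b → sum (common a b) ≡ 2
  sum-common-≁ {a} {b} a≢b a≁b =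
    trans (sym (∣tabulate-∩∣ (adj a) (adj b))) (proj₂ (proj₂ srg) a b a≢b (≁⇒false a≁b))

  triangle : ∀ {a b c} → a ~ b → b ~ c → a ~ c → ⊥
  triangle {a} {b} a~b b~c a~c =
    <⇒≱ z<s (subst (1 ≤_) (sum-common-~ a~b) (length≤sum (common a b) ([] ∷ []) (common-~ a~c b~c ∷ [])))

  at-most-two : ∀ {a b x y z} → a ≢ b → ¬ a ~ b → a ~ x → b ~ x → a ~ y → b ~ y → a ~ z → b ~ z →
                x ≢ y → x ≢ z → y ≢ z → ⊥
  at-most-two {a} {b} a≢b a≁b ax bx ay by az bz x≢y x≢z y≢z =
    <⇒≱ (from-yes (2 <? 3)) (subst (3 ≤_) (sum-common-≁ a≢b a≁b)
      (length≤sum (common a b) ((x≢y ∷ x≢z ∷ []) ∷ (y≢z ∷ []) ∷ [] ∷ [])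
                  (common-~ ax bx ∷ common-~ ay by ∷ common-~ az bz ∷ [])))

  common-neighbour : ∀ {a b} → a ≢ b → ¬ a ~ b → ∃ λ x → a ~ x × b ~ x
  common-neighbour {a} {b} a≢b a≁b
    with x , x>0 , _ ← outside (common a b) (common≤1 a b) [] (subst (0 <_) (sym (sum-common-≁ a≢b a≁b)) z<s) =
    x , common>0 x>0

  other-common : ∀ {a b} x → a ≢ b → ¬ a ~ b → ∃ λ y → a ~ y × b ~ y × x ≢ y
  other-common {a} {b} x a≢b a≁b
    with y , y>0 , x≢y ∷ [] ← outside (common a b) (common≤1 a b) (x ∷ []) (subst (1 <_) (sym (sum-common-≁ a≢b a≁b)) (s<s z<s)) =
    y , proj₁ (common>0 y>0) , proj₂ (common>0 y>0) , x≢y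

  neighbours≤10 : ∀ {v xs} → Unique xs → All (v ~_) xs → length xs ≤ 10
  neighbours≤10 {v} xs! v~xs = subst (_ ≤_) (sum-χ v) (length≤sum (χ v) xs! (All.map χ-~ v~xs))

  new-neighbour : ∀ {v} xs → length xs < 10 → ∃ λ u → v ~ u × All (_≢ u) xs
  new-neighbour {v} xs xs<10
    with u , u>0 , u∉xs ← outside (χ v) (λ u → ⟦⟧≤1 (adj v u)) xs (subst (length xs <_) (sym (sum-χ v)) xs<10) =
    u , χ>0 u>0 , u∉xs

  -- Cubes

  -- The cube K₄,₄ minus a perfect matching, antipodes being e i and o i.
  record Cube : Set where
    field
      e o  : Fin 4 → V
      edge : ∀ {i j} → i ≢ j → e i ~ o j
      e-≢  : ∀ {i j} → i ≢ j → e i ≢ e j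
      o-≢  : ∀ {i j} → i ≢ j → o i ≢ o j

  swap : Cube → Cube
  swap C = record { e = o ; o = e ; edge = λ i≢j → ~-sym (edge (i≢j ∘ sym)) ; e-≢ = o-≢ ; o-≢ = e-≢ }
    where open Cube C

  -- For such a `k`, the vertex `o k` of a cube is adjacent to both `e i` and `e j`.
  third : (i j : Fin 4) → ∃ λ k → i ≢ k × j ≢ k
  third 0F 0F = 1F , (λ ()) , (λ ())
  third 0F 1F = 2F , (λ ()) , (λ ())
  third 0F (suc (suc j)) = 1F , (λ ()) , (λ ())
  third 1F 0F = 2F , (λ ()) , (λ ())
  third (suc (suc j)) 0F = 1F , (λ ()) , (λ ())
  third (suc i) (suc j) = 0F , (λ ()) , (λ ())

  module CubeProperties (C : Cube) where
    open Cube C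

    ee-≁ : ∀ i j → ¬ e i ~ e j
    ee-≁ i j ei~ej with k , i≢k , j≢k ← third i j = triangle ei~ej (edge j≢k) (edge i≢k)

    -- If the antipodes were adjacent, `e i` and `e j` would share the three neighbours `o i`, `o k`
    -- and `o l`, where `j`, `k`, `l` are the other indices.
    eo-≁ : ∀ i → ¬ e i ~ o i
    eo-≁ i ei~oi =
      at-most-two (e-≢ i≢j) (ee-≁ i j) ei~oi (edge (i≢j ∘ sym)) (edge i≢k) (edge (j≢ λ ())) (edge i≢l) (edge (j≢ λ ()))
                  (o-≢ i≢k) (o-≢ i≢l) (o-≢ (j≢ λ ()))
      where
      j k l : Fin 4
      j = punchIn i 0F
      k = punchIn i 1F
      l = punchIn i 2F
      i≢j : i ≢ j
      i≢j = punchInᵢ≢i i 0F ∘ sym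
      i≢k : i ≢ k
      i≢k = punchInᵢ≢i i 1F ∘ sym
      i≢l : i ≢ l
      i≢l = punchInᵢ≢i i 2F ∘ sym
      j≢ : ∀ {s t} → s ≢ t → punchIn i s ≢ punchIn i t
      j≢ s≢t = s≢t ∘ punchIn-injective i _ _

    eo-≢ : ∀ i j → e i ≢ o j
    eo-≢ i j ei≡oj with k , i≢k , j≢k ← third i j =
      ee-≁ i k (~-sym (subst (e k ~_) (sym ei≡oj) (edge (j≢k ∘ sym))))

    common-ee : ∀ i j → sum (common (e i) (e j)) ≡ (if does (i ≟ j) then 10 else 2)
    common-ee i j with i ≟ j
    ... | yes refl = sum-common-self (e i)
    ... | no i≢j   = sum-common-≁ (e-≢ i≢j) (ee-≁ i j)

    common-eo : ∀ i j → sum (common (e i) (o j)) ≡ (if does (i ≟ j) then 2 else 0)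
    common-eo i j with i ≟ j
    ... | yes refl = sum-common-≁ (eo-≢ i i) (eo-≁ i)
    ... | no i≢j   = sum-common-~ (edge i≢j)

    -- 16 = 10 + 3 · 2: the degree for `j = i`, and μ for each of the other three.
    row-ee : ∀ i → sum (λ j → sum (common (e i) (e j))) ≡ 16
    row-ee i = trans (sum-cong-≗ (common-ee i)) (table i)
      where
      table : (i : Fin 4) → sum {4} (λ j → if does (i ≟ j) then 10 else 2) ≡ 16
      table 0F = refl
      table 1F = refl
      table 2F = refl
      table 3F = refl

    row-eo : ∀ i → sum (λ j → sum (common (e i) (o j))) ≡ 2
    row-eo i = trans (sum-cong-≗ (common-eo i)) (table i)
      where
      table : (i : Fin 4) → sum {4} (λ j → if does (i ≟ j) then 2 else 0) ≡ 2
      table 0F = refl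
      table 1F = refl
      table 2F = refl
      table 3F = refl

    χ-ee : ∀ k → sum (λ i → χ (e i) (e k)) ≡ 0
    χ-ee k = trans (sum-cong-≗ (λ i → χ-≁ (ee-≁ i k))) (sum-replicate-zero 4)

    χ-oe : ∀ k → sum (λ i → χ (o i) (e k)) ≡ 3
    χ-oe k = trans (sum-cong-≗ entry) (table k)
      where
      entry : ∀ i → χ (o i) (e k) ≡ (if does (i ≟ k) then 0 else 1)
      entry i with i ≟ k
      ... | yes refl = χ-≁ (eo-≁ i ∘ ~-sym)
      ... | no i≢k   = χ-~ (~-sym (edge (i≢k ∘ sym)))
      table : (k : Fin 4) → sum {4} (λ i → if does (i ≟ k) then 0 else 1) ≡ 3
      table 0F = refl
      table 1F = refl
      table 2F = refl
      table 3F = refl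

    module _ {x} (x~e : x ~ e 0F) (x~o : x ~ o 0F) where

      x-≁ : ∀ {j} → 0F ≢ j → ¬ x ~ e j
      x-≁ 0≢j x~ej = triangle x~o (~-sym (edge (0≢j ∘ sym))) x~ej

      -- 6 = 0 + 3 · 2: λ for the neighbour `e 0F` of `x`, and μ for the other three, to which `x`
      -- is not adjacent.
      row-xe : sum (λ j → sum (common x (e j))) ≡ 6
      row-xe = trans (sum-cong-≗ entry) refl
        where
        entry : ∀ j → sum (common x (e j)) ≡ (if does (0F ≟ j) then 0 else 2)
        entry j with 0F ≟ j
        ... | yes refl = sum-common-~ x~e
        ... | no 0≢j   = sum-common-≁ (λ { refl → ee-≁ j 0F x~e }) (x-≁ 0≢j)

  sum-*-sum : ∀ {m} (φ : V → ℕ) (c : Fin m → V) →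
              sum (λ u → φ u * sum (λ i → χ (c i) u)) ≡ sum (λ i → sum (λ u → φ u * χ (c i) u))
  sum-*-sum φ c = trans (sum-cong-≗ (λ u → *-distribˡ-sum (φ u) (λ i → χ (c i) u)))
                        (∑-comm (λ u i → φ u * χ (c i) u))

  -- Exclusion of cubes on 56 vertices

  module _ (n≡56 : n ≡ 56) (C : Cube) where
    open Cube C
    private
      module E = CubeProperties C
      module O = CubeProperties (swap C)

    f : V → ℕ
    f u = sum (λ i → χ (e i) u) + sum (λ i → χ (o i) u)

    sum-*f : ∀ φ → sum (λ u → φ u * f u) ≡
                   sum (λ i → sum (λ u → φ u * χ (e i) u)) + sum (λ i → sum (λ u → φ u * χ (o i) u))
    sum-*f φ = begin
      sum (λ u → φ u * f u)
        ≡⟨ sum-cong-≗ (λ u → *-distribˡ-+ (φ u) _ _) ⟩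
      sum (λ u → φ u * sum (λ i → χ (e i) u) + φ u * sum (λ i → χ (o i) u))
        ≡⟨ ∑-distrib-+ (λ u → φ u * sum (λ i → χ (e i) u)) (λ u → φ u * sum (λ i → χ (o i) u)) ⟩
      sum (λ u → φ u * sum (λ i → χ (e i) u)) + sum (λ u → φ u * sum (λ i → χ (o i) u))
        ≡⟨ cong₂ _+_ (sum-*-sum φ e) (sum-*-sum φ o) ⟩
      sum (λ i → sum (λ u → φ u * χ (e i) u)) + sum (λ i → sum (λ u → φ u * χ (o i) u)) ∎
      where open ≡-Reasoning

    sum-f : sum f ≡ 80
    sum-f = begin
      sum f                ≡⟨ sum-cong-≗ (λ u → sym (*-identityˡ (f u))) ⟩
      sum (λ u → 1 * f u)  ≡⟨ sum-*f (λ _ → 1) ⟩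
      _                    ≡⟨ cong₂ _+_ (sum-cong-≗ (degree-1* ∘ e)) (sum-cong-≗ (degree-1* ∘ o)) ⟩
      80                   ∎
      where
      open ≡-Reasoning
      degree-1* : ∀ a → sum (λ u → 1 * χ a u) ≡ 10
      degree-1* a = trans (sum-cong-≗ (λ u → *-identityˡ (χ a u))) (sum-χ a)

    -- Expanding one factor `f` over the eight cube vertices gives 8 · (16 + 2).
    sum-ff : sum (λ u → f u * f u) ≡ 144
    sum-ff = trans (sum-*f f) (cong₂ _+_ (sum-cong-≗ row-e) (sum-cong-≗ row-o))
      where
      row-e : ∀ i → sum (λ u → f u * χ (e i) u) ≡ 18
      row-e i = trans (sum-cong-≗ (λ u → *-comm (f u) (χ (e i) u)))
                      (trans (sum-*f (χ (e i))) (cong₂ _+_ (E.row-ee i) (E.row-eo i)))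
      row-o : ∀ i → sum (λ u → f u * χ (o i) u) ≡ 18
      row-o i = trans (sum-cong-≗ (λ u → *-comm (f u) (χ (o i) u)))
                      (trans (sum-*f (χ (o i))) (cong₂ _+_ (O.row-eo i) (O.row-ee i)))

    f-e : ∀ i → f (e i) ≡ 3
    f-e i = cong₂ _+_ (E.χ-ee i) (E.χ-oe i)

    f-o : ∀ i → f (o i) ≡ 3
    f-o i = cong₂ _+_ (O.χ-oe i) (O.χ-ee i)

    cube-unique : Unique (e 0F ∷ e 1F ∷ e 2F ∷ e 3F ∷ o 0F ∷ o 1F ∷ o 2F ∷ o 3F ∷ [])
    cube-unique =
      (e-≢ (λ ()) ∷ e-≢ (λ ()) ∷ e-≢ (λ ()) ∷ e≢o 0F) ∷ (e-≢ (λ ()) ∷ e-≢ (λ ()) ∷ e≢o 1F) ∷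
      (e-≢ (λ ()) ∷ e≢o 2F) ∷ e≢o 3F ∷
      (o-≢ (λ ()) ∷ o-≢ (λ ()) ∷ o-≢ (λ ()) ∷ []) ∷ (o-≢ (λ ()) ∷ o-≢ (λ ()) ∷ []) ∷ (o-≢ (λ ()) ∷ []) ∷ [] ∷ []
      where
      e≢o : ∀ i → All (e i ≢_) (o 0F ∷ o 1F ∷ o 2F ∷ o 3F ∷ [])
      e≢o i = E.eo-≢ i 0F ∷ E.eo-≢ i 1F ∷ E.eo-≢ i 2F ∷ E.eo-≢ i 3F ∷ []

    no-cube : ⊥
    no-cube
      with x , e~x , o~x ← common-neighbour (E.eo-≢ 0F 0F) (E.eo-≁ 0F) =
      <⇒≱ (from-yes (20 <? 24)) (subst₂ _≤_ cube-slack sum-slack (partial-sum slack cube-unique))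
      where
      open ≡-Reasoning
      x~e : x ~ e 0F
      x~e = ~-sym e~x
      x~o : x ~ o 0F
      x~o = ~-sym o~x

      -- slack u = (f u − 1)(f u − 2 + 2 χ x u), a product of integers that is never negative.
      upper lower slack : V → ℕ
      upper u = f u * f u + 2 * (χ x u * f u) + 2
      lower u = 3 * f u + 2 * χ x u
      slack u = upper u ∸ lower u

      -- The two factors are consecutive integers: `f u − 2` and `f u − 1` if `x` is not adjacent to
      -- `u`, else `f u − 1` and `f u`. So the truncated subtraction in `slack` is exact.
      lower≤upper : ∀ u → lower u ≤ upper u
      lower≤upper u = quadratic (f u) (adj x u)
        where
        quadratic : ∀ m b → 3 * m + 2 * ⟦ b ⟧ ≤ m * m + 2 * (⟦ b ⟧ * m) + 2
        quadratic 0 true  = ≤-refl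
        quadratic 0 false = z≤n
        quadratic 1 true  = ≤-refl
        quadratic 1 false = ≤-refl
        quadratic (suc (suc m)) true  = ≤-trans (m≤m+n _ (2 + 3 * m + m * m)) (≤-reflexive (eq m))
          where
          eq : ∀ m → 3 * (2 + m) + 2 * 1 + (2 + 3 * m + m * m) ≡ (2 + m) * (2 + m) + 2 * (1 * (2 + m)) + 2
          eq = solve-∀
        quadratic (suc (suc m)) false = ≤-trans (m≤m+n _ (m + m * m)) (≤-reflexive (eq m))
          where
          eq : ∀ m → 3 * (2 + m) + 2 * 0 + (m + m * m) ≡ (2 + m) * (2 + m) + 2 * (0 * (2 + m)) + 2
          eq = solve-∀

      sum-upper : sum upper ≡ 280
      sum-upper = begin
        sum upper
          ≡⟨ ∑-distrib-+ (λ u → f u * f u + 2 * (χ x u * f u)) (λ _ → 2) ⟩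
        sum (λ u → f u * f u + 2 * (χ x u * f u)) + sum {n} (λ _ → 2)
          ≡⟨ cong₂ _+_ (∑-distrib-+ (λ u → f u * f u) (λ u → 2 * (χ x u * f u))) (sum-const n 2) ⟩
        sum (λ u → f u * f u) + sum (λ u → 2 * (χ x u * f u)) + n * 2
          ≡⟨ cong (λ s → sum (λ u → f u * f u) + s + n * 2) (*-distribˡ-sum 2 (λ u → χ x u * f u)) ⟨
        sum (λ u → f u * f u) + 2 * sum (λ u → χ x u * f u) + n * 2
          -- 144 + 2 · (6 + 6) + 56 · 2. The number of vertices enters the count only here;
          -- elsewhere `n` is a variable, so `sum` does not unfold.
          ≡⟨ evaluate sum-ff (trans (sum-*f (χ x)) (cong₂ _+_ (E.row-xe x~e x~o) (O.row-xe x~o x~e))) n≡56 ⟩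
        280 ∎
        where
        evaluate : ∀ {s t m} → s ≡ 144 → t ≡ 12 → m ≡ 56 → s + 2 * t + m * 2 ≡ 280
        evaluate refl refl refl = refl

      sum-lower : sum lower ≡ 260
      sum-lower = begin
        sum lower
          ≡⟨ ∑-distrib-+ (λ u → 3 * f u) (λ u → 2 * χ x u) ⟩
        sum (λ u → 3 * f u) + sum (λ u → 2 * χ x u)
          ≡⟨ cong₂ _+_ (*-distribˡ-sum 3 f) (*-distribˡ-sum 2 (χ x)) ⟨
        3 * sum f + 2 * sum (χ x)
          ≡⟨ cong₂ (λ s t → 3 * s + 2 * t) sum-f (sum-χ x) ⟩
        260 ∎

      sum-slack : sum slack ≡ 20
      sum-slack = +-cancelˡ-≡ 260 _ _ (begin
        260 + sum slack               ≡⟨ cong (_+ sum slack) {x = sum lower} {y = 260} sum-lower ⟨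
        sum lower + sum slack         ≡⟨ ∑-distrib-+ lower slack ⟨
        sum (λ u → lower u + slack u) ≡⟨ sum-cong-≗ (λ u → m+[n∸m]≡n (lower≤upper u)) ⟩
        sum upper                     ≡⟨ sum-upper ⟩
        280                           ∎)

      -- The right side is 6 for `k = 1`, the case of `e 0F` and `o 0F`, and 2 for `k = 0`, the case
      -- of the other six cube vertices.
      slack-≡ : ∀ {u k} → f u ≡ 3 → χ x u ≡ k → slack u ≡ 9 + 2 * (k * 3) + 2 ∸ (9 + 2 * k)
      slack-≡ = cong₂ (λ m k → m * m + 2 * (k * m) + 2 ∸ (3 * m + 2 * k))

      slack-e : ∀ {i} → 0F ≢ i → slack (e i) ≡ 2
      slack-e {i} 0≢i = slack-≡ (f-e i) (χ-≁ (E.x-≁ x~e x~o 0≢i))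

      slack-o : ∀ {i} → 0F ≢ i → slack (o i) ≡ 2
      slack-o {i} 0≢i = slack-≡ (f-o i) (χ-≁ (O.x-≁ x~o x~e 0≢i))

      cube-slack : ListAction.sum (List.map slack (e 0F ∷ e 1F ∷ e 2F ∷ e 3F ∷ o 0F ∷ o 1F ∷ o 2F ∷ o 3F ∷ [])) ≡ 24
      cube-slack =
        cong₂ _+_ (slack-≡ (f-e 0F) (χ-~ x~e)) (cong₂ _+_ (slack-e λ ()) (cong₂ _+_ (slack-e λ ()) (cong₂ _+_ (slack-e λ ())
        (cong₂ _+_ (slack-≡ (f-o 0F) (χ-~ x~o)) (cong₂ _+_ (slack-o λ ()) (cong₂ _+_ (slack-o λ ()) (cong₂ _+_ (slack-o λ ()) refl)))))))

  -- Components of the plus graph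

  -- An `Edge` stores its ends in increasing order; this reads it in either direction.
  data Spans : Edge Γ → V → V → Set where
    forward  : ∀ {a b p} → Spans ((a , b) , p) a b
    backward : ∀ {a b p} → Spans ((a , b) , p) b a

  spans-swap : ∀ {e a b} → Spans e a b → Spans e b a
  spans-swap forward  = backward
  spans-swap backward = forward

  spanning : ∀ {a b} → a ~ b → ∃ λ e → Spans e a b
  spanning {a} {b} a~b with <-cmp a b
  ... | tri< a<b _ _ = ((a , b) , a<b , a~b) , forward
  ... | tri≈ _ a≡b _ = contradiction a≡b (~⇒≢ a~b)
  ... | tri> _ _ b<a = ((b , a) , b<a , ~-sym a~b) , backward

  -- The proofs stored in an edge are irrelevant, and opposite readings would give both `a < b` and
  -- `b < a`.
  spans-unique : ∀ {e f a b} → Spans e a b → Spans f a b → e ≡ f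
  spans-unique {_ , p , q} {_ , p′ , q′} forward forward =
    cong₂ (λ p q → _ , p , q) (<-irrelevant p p′) (≡-irrelevant q q′)
  spans-unique {_ , p , q} {_ , p′ , q′} backward backward =
    cong₂ (λ p q → _ , p , q) (<-irrelevant p p′) (≡-irrelevant q q′)
  spans-unique {_ , p , _} {_ , p′ , _} forward backward = contradiction p′ (<-asym p)
  spans-unique {_ , p , _} {_ , p′ , _} backward forward = contradiction p′ (<-asym p)

  opposite : ∀ {a b c d e f} → a ~ b → b ~ c → c ~ d → d ~ a → a ≢ c → b ≢ d →
             Spans e a b → Spans f c d → PlusAdj Γ e f
  opposite ab bc cd da a≢c b≢d forward forward =
    (a≢c , ~⇒≢ (~-sym da) , ~⇒≢ bc , b≢d) , inj₁ (bc , da)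
  opposite ab bc cd da a≢c b≢d forward backward =
    (~⇒≢ (~-sym da) , a≢c , b≢d , ~⇒≢ bc) , inj₂ (bc , da)
  opposite ab bc cd da a≢c b≢d backward forward =
    (~⇒≢ bc , b≢d , a≢c , ~⇒≢ (~-sym da)) , inj₂ (~-sym da , ~-sym bc)
  opposite ab bc cd da a≢c b≢d backward backward =
    (b≢d , ~⇒≢ bc , ~⇒≢ (~-sym da) , a≢c) , inj₁ (~-sym da , ~-sym bc)

  PlusAdj-sym : ∀ e f → PlusAdj Γ e f → PlusAdj Γ f e
  PlusAdj-sym _ _ ((a≢c , a≢d , b≢c , b≢d) , inj₁ (bc , da)) =
    (a≢c ∘ sym , b≢c ∘ sym , a≢d ∘ sym , b≢d ∘ sym) , inj₁ (da , bc)
  PlusAdj-sym _ _ ((a≢c , a≢d , b≢c , b≢d) , inj₂ (bd , ca)) =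
    (a≢c ∘ sym , b≢c ∘ sym , a≢d ∘ sym , b≢d ∘ sym) , inj₂ (~-sym bd , ~-sym ca)

  -- Quantifying over all spanning edges makes the relation blind to orientation. The stored
  -- adjacencies ensure that such edges exist, which transitivity uses for its middle edge.
  record Joined (a b c d : V) : Set where
    constructor joined
    field
      source : a ~ b
      target : c ~ d
      star   : ∀ {e f} → Spans e a b → Spans f c d → Star (PlusAdj Γ) e f

  joined-refl : ∀ {a b} → a ~ b → Joined a b a b
  joined-refl a~b = joined a~b a~b λ s t → subst (Star _ _) (spans-unique s t) ε

  joined-sym : ∀ {a b c d} → Joined a b c d → Joined c d a b
  joined-sym (joined ab cd s) = joined cd ab λ p q → Star-reverse (λ {e} {f} → PlusAdj-sym e f) (s q p)

  joined-trans : ∀ {a b c d a′ b′} → Joined a b c d → Joined c d a′ b′ → Joined a b a′ b′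
  joined-trans (joined ab cd s) (joined _ ab′ s′) =
    joined ab ab′ λ p q → let _ , r = spanning cd in s p r ◅◅ s′ r q

  joined-swap : ∀ {a b c d} → Joined a b c d → Joined a b d c
  joined-swap (joined ab cd s) = joined ab (~-sym cd) λ p q → s p (spans-swap q)

  joined-opposite : ∀ {a b c d} → a ~ b → b ~ c → c ~ d → d ~ a → a ≢ c → b ≢ d → Joined a b c d
  joined-opposite ab bc cd da a≢c b≢d = joined ab cd λ p q → opposite ab bc cd da a≢c b≢d p q ◅ ε

  -- The 2-regular graph on N(v) ∖ N(P)

  module _ (n≡56 : n ≡ 56) {v P : V} (v≢P : v ≢ P) (v≁P : ¬ v ~ P) where

    -- That `a` and `b` lie outside N(P) is derived: with `Q`, such an adjacency would close a
    -- triangle.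
    record Link (a b : V) : Set where
      constructor link
      field
        Q    : V
        v~a  : v ~ a
        v~b  : v ~ b
        Q~a  : Q ~ a
        Q~b  : Q ~ b
        Q~P  : Q ~ P
        a≢b  : a ≢ b

      v≢Q : v ≢ Q
      v≢Q v≡Q = v≁P (subst (_~ P) (sym v≡Q) Q~P)

      v≁Q : ¬ v ~ Q
      v≁Q v~Q = triangle v~Q Q~a v~a

      P≁a : ¬ P ~ a
      P≁a P~a = triangle Q~P P~a Q~a

      a≢P : a ≢ P
      a≢P a≡P = v≁P (subst (v ~_) a≡P v~a)

      b≢P : b ≢ P
      b≢P b≡P = v≁P (subst (v ~_) b≡P v~b)

    open Link using (Q)

    link-sym : ∀ {a b} → Link a b → Link b a
    link-sym (link Q va vb Qa Qb QP a≢b) = link Q vb va Qb Qa QP (a≢b ∘ sym)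

    -- Otherwise Q l would share the three neighbours a, b, c with v.
    link-Q≢ : ∀ {a b c d} (l : Link a b) (m : Link c d) → a ≢ c → b ≢ c → Q l ≢ Q m
    link-Q≢ {c = c} l m a≢c b≢c Q≡Q =
      at-most-two l.v≢Q l.v≁Q l.v~a l.Q~a l.v~b l.Q~b m.v~a (subst (_~ c) (sym Q≡Q) m.Q~a) l.a≢b a≢c b≢c
      where
      module l = Link l
      module m = Link m

    -- `q` and `v` are not adjacent, because of `a`, so they have a second common neighbour. The
    -- equation on `Q` lets `link-next` pass to a different middle vertex.
    link-via : ∀ {a q} → v ~ a → q ~ a → q ~ P → Σ V λ b → Σ (Link a b) λ l → Q l ≡ q
    link-via {a} {q} va qa qP
      with b , vb , qb , a≢b ← other-common a (λ { refl → v≁P qP }) (λ vq → triangle vq qa va) =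
      b , link q va vb qa qb qP a≢b , refl

    link-from : ∀ {a} → v ~ a × ¬ P ~ a → ∃ λ b → Link a b
    link-from (va , P≁a)
      with q , Pq , aq ← common-neighbour (λ { refl → v≁P va }) P≁a
      with b , l , _ ← link-via va (~-sym aq) (~-sym Pq) = b , l

    link-next : ∀ {a b} → Link a b → ∃ λ c → Link b c × a ≢ c
    link-next {a} {b} l
      with q , Pq , bq , Q≢q ← other-common (Q l) (Link.b≢P l ∘ sym) (Link.P≁a (link-sym l))
      with c , m , refl ← link-via (Link.v~b l) (~-sym bq) (~-sym Pq)
      -- If `c` were `a`, then `a` and `b` would share `v`, `Q l` and `q`.
      = c , m , λ { refl → at-most-two l.a≢b a≁b
                             (~-sym l.v~a) (~-sym l.v~b) (~-sym l.Q~a) (~-sym l.Q~b) (~-sym (Link.Q~b m)) (~-sym (Link.Q~a m))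
                             l.v≢Q (Link.v≢Q m) Q≢q }
      where
      module l = Link l
      a≁b : ¬ a ~ b
      a≁b ab = triangle l.v~a ab l.v~b

    -- Three links at `q` would give `q` and `P` three distinct common neighbours, namely their
    -- middle vertices.
    link-atMostTwo : ∀ {q a b c} → Link q a → Link q b → Link q c → a ≢ b → a ≢ c → b ≢ c → ⊥
    link-atMostTwo l m k a≢b a≢c b≢c =
      at-most-two l.a≢P (l.P≁a ∘ ~-sym)
        (~-sym l.Q~a) (~-sym l.Q~P) (~-sym m.Q~a) (~-sym m.Q~P) (~-sym k.Q~a) (~-sym k.Q~P)
        (link-Q≢ l (link-sym m) m.a≢b a≢b) (link-Q≢ l (link-sym k) k.a≢b a≢c) (link-Q≢ m (link-sym k) k.a≢b b≢c)
      where
      module l = Link l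
      module m = Link m
      module k = Link k

    -- A triangle spans a cube with antipodes v and P.
    link-triangleFree : ∀ {a b c} → Link a b → Link b c → Link c a → ⊥
    link-triangleFree {a} {b} {c} ab bc ca = no-cube n≡56 (record
      { e    = Vec.lookup es
      ; o    = Vec.lookup os
      ; edge = edge
      ; e-≢  = λ i≢j → i≢j ∘ lookup-injective
          ((bc.v≢Q ∷ ca.v≢Q ∷ ab.v≢Q ∷ []) ∷
           (link-Q≢ bc (link-sym ca) (ab.a≢b ∘ sym) ca.a≢b ∷ link-Q≢ bc ab (ab.a≢b ∘ sym) ca.a≢b ∷ []) ∷
           (link-Q≢ ca (link-sym ab) (bc.a≢b ∘ sym) ab.a≢b ∷ []) ∷ [] ∷ []) _ _
      ; o-≢  = λ i≢j → i≢j ∘ lookup-injective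
          (((ab.a≢P ∘ sym) ∷ (bc.a≢P ∘ sym) ∷ (ca.a≢P ∘ sym) ∷ []) ∷
           (ab.a≢b ∷ (ca.a≢b ∘ sym) ∷ []) ∷ (bc.a≢b ∷ []) ∷ [] ∷ []) _ _
      })
      where
      module ab = Link ab
      module bc = Link bc
      module ca = Link ca
      es os : Vec V 4
      es = v ∷ bc.Q ∷ ca.Q ∷ ab.Q ∷ []
      os = P ∷ a ∷ b ∷ c ∷ []
      edge : ∀ {i j} → i ≢ j → Vec.lookup es i ~ Vec.lookup os j
      edge {0F} {0F} i≢j = contradiction refl i≢j
      edge {0F} {1F} _   = ab.v~a
      edge {0F} {2F} _   = bc.v~a
      edge {0F} {3F} _   = ca.v~a
      edge {1F} {0F} _   = bc.Q~P
      edge {1F} {1F} i≢j = contradiction refl i≢j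
      edge {1F} {2F} _   = bc.Q~a
      edge {1F} {3F} _   = bc.Q~b
      edge {2F} {0F} _   = ca.Q~P
      edge {2F} {1F} _   = ca.Q~b
      edge {2F} {2F} i≢j = contradiction refl i≢j
      edge {2F} {3F} _   = ca.Q~a
      edge {3F} {0F} _   = ab.Q~P
      edge {3F} {1F} _   = ab.Q~a
      edge {3F} {2F} _   = ab.Q~b
      edge {3F} {3F} i≢j = contradiction refl i≢j

    -- va and Qb are opposite in the 4-cycle v a Q b, and Qb and Q′P in the 4-cycle Q b Q′ P, where Q = Q l, Q′ = Q m.
    half-shift : ∀ {a b c} (l : Link a b) (m : Link b c) → a ≢ c → Joined v a P (Q m)
    half-shift l m a≢c = joined-trans
      (joined-opposite l.v~a (~-sym l.Q~a) l.Q~b (~-sym l.v~b) l.v≢Q l.a≢b)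
      (joined-swap (joined-opposite l.Q~b (~-sym m.Q~a) m.Q~P (~-sym l.Q~P)
        (link-Q≢ l (link-sym m) a≢c m.a≢b) l.b≢P))
      where
      module l = Link l
      module m = Link m

    -- Both ends are joined to the edge from `P` to `Q bc`: the path is read once in each direction,
    -- and `link-sym` keeps `Q`.
    link-shift : ∀ {a b c d} → Link a b → Link b c → Link c d → a ≢ c → b ≢ d → Joined v a v d
    link-shift ab bc cd a≢c b≢d = joined-trans
      (half-shift ab bc a≢c)
      (joined-sym (half-shift (link-sym cd) (link-sym bc) (b≢d ∘ sym)))

    -- `x` and `y` are all the common neighbours of `v` and `P`, so 10 - 2 = 8 points remain.
    octet : ∀ {x y} → v ~ x → P ~ x → v ~ y → P ~ y → x ≢ y → ShiftedOctet (λ x y → Joined v x v y)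
    octet {x} {y} vx Px vy Py x≢y = record
      { S            = λ a → v ~ a × ¬ P ~ a
      ; _∼_          = Link
      ; ∼-sym        = link-sym
      ; ∼⇒≢          = Link.a≢b
      ; ∼⇒S          = λ l → Link.v~a l , Link.P≁a l
      ; neighbour    = link-from
      ; next         = link-next
      ; atMostTwo    = link-atMostTwo
      ; triangleFree = link-triangleFree
      ; atMostEight  = λ xs! Sxs → +-cancelˡ-≤ 2 _ _ (neighbours≤10
          ((x≢y ∷ All.map (away Px) Sxs) ∷ All.map (away Py) Sxs ∷ xs!) (vx ∷ vy ∷ All.map proj₁ Sxs))
      ; atLeastEight = atLeastEight
      ; shift        = link-shift
      }
      where
      away : ∀ {x a} → P ~ x → v ~ a × ¬ P ~ a → x ≢ a
      away Px (_ , P≁a) refl = P≁a Px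
      atLeastEight : ∀ {xs} → length xs < 8 → ∃ λ r → (v ~ r × ¬ P ~ r) × All (_≢ r) xs
      atLeastEight {xs} xs<8
        with u , vu , x≢u ∷ y≢u ∷ u∉xs ← new-neighbour (x ∷ y ∷ xs) (+-monoʳ-< 2 xs<8) =
        u , (vu , λ Pu → at-most-two v≢P v≁P vx Px vy Py vu Pu x≢y x≢u y≢u) , u∉xs

  -- Edges at a vertex and connectedness

  module _ (n≡56 : n ≡ 56) where

    opaque
      three-joined : ∀ {v x y a} → v ~ x → v ~ y → x ≢ y → v ~ a → x ≢ a → y ≢ a →
                     ThreeMore (λ b → v ~ b × x ≢ b × y ≢ b) (λ b c → Joined v b v c) a
      three-joined {v} {x} {y} {a} vx vy x≢y va x≢a y≢a
        -- Taking `P` as the second common neighbour of `x` and `y` makes these two the points of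
        -- N(v) that are left out.
        with P , xP , yP , v≢P ← other-common v x≢y (λ xy → triangle vx xy vy) =
        ThreeMore-map away (three-more _≟_ {λ b c → Joined v b v c} joined-sym joined-trans
          (octet n≡56 v≢P v≁P vx (~-sym xP) vy (~-sym yP) x≢y)
          (va , λ Pa → at-most-two v≢P v≁P vx (~-sym xP) vy (~-sym yP) va Pa x≢y x≢a y≢a))
        where
        v≁P : ¬ v ~ P
        v≁P vP = triangle vx xP vP
        away : ∀ {b} → v ~ b × ¬ P ~ b → v ~ b × x ≢ b × y ≢ b
        away (vb , P≁b) = vb , (λ { refl → P≁b (~-sym xP) }) , (λ { refl → P≁b (~-sym yP) })

    opaque
      -- A first choice of `P` puts `b` and `c` in the class of `a`; a second choice leaves out
      -- exactly `b` and `c`, so its three further points are new.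
      six-joined : ∀ {v a} → v ~ a → ∃ λ xs → Unique xs × length xs ≡ 6 × All (v ~_) xs × All (λ x → Joined v a v x) xs
      six-joined {v} {a} va
        with x , vx , a≢x ∷ [] ← new-neighbour (a ∷ []) (s<s z<s)
        with y , vy , a≢y ∷ x≢y ∷ [] ← new-neighbour (a ∷ x ∷ []) (s<s (s<s z<s))
        with threeMore {b} {c} {_} ((a≢b ∷ a≢c ∷ _) ∷ (b≢c ∷ _) ∷ _) ((vb , _) ∷ (vc , _) ∷ _) (ab ∷ ac ∷ _)
               ← three-joined vx vy x≢y va (a≢x ∘ sym) (a≢y ∘ sym)
        with threeMore {d} {e} {f} u@((a≢d ∷ _) ∷ _)
               ((vd , b≢d , c≢d) ∷ (ve , b≢e , c≢e) ∷ (vf , b≢f , c≢f) ∷ []) related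
               ← three-joined vb vc b≢c va (a≢b ∘ sym) (a≢c ∘ sym) =
        b ∷ c ∷ a ∷ d ∷ e ∷ f ∷ [] ,
        (b≢c ∷ (a≢b ∘ sym) ∷ b≢d ∷ b≢e ∷ b≢f ∷ []) ∷ ((a≢c ∘ sym) ∷ c≢d ∷ c≢e ∷ c≢f ∷ []) ∷ u ,
        refl ,
        vb ∷ vc ∷ va ∷ vd ∷ ve ∷ vf ∷ [] ,
        ab ∷ ac ∷ joined-refl va ∷ related

    -- Two sets of six among ten neighbours meet.
    joined-star : ∀ {v a b} → v ~ a → v ~ b → Joined v a v b
    joined-star {v} {a} {b} va vb
      with xs , xs! , ∣xs∣ , vxs , axs ← six-joined va
      with ys , ys! , ∣ys∣ , vys , bys ← six-joined vb
      with any? (λ x → x ∈? ys) xs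
    ... | yes meet =
          let x , x∈xs , x∈ys = find meet in
          joined-trans (All.lookup axs x∈xs) (joined-sym (All.lookup bys x∈ys))
    ... | no disjoint = contradiction
          (neighbours≤10 (++⁺ xs! ys! λ { (x∈xs , x∈ys) → disjoint (lose x∈xs x∈ys) }) (All-++⁺ vxs vys))
          (<⇒≱ (subst (10 <_) (sym (trans (length-++ xs) (cong₂ _+_ ∣xs∣ ∣ys∣))) (from-yes (10 <? 12))))

    all-joined : ∀ {a b c d} → a ~ b → c ~ d → Joined a b c d
    all-joined {a} {b} {c} {d} ab cd with a ≟ c | adj a c Bool.≟ true
    ... | yes refl | _      = joined-star ab cd
    ... | no _     | yes ac = joined-trans (joined-swap (joined-star ab ac)) (joined-star (~-sym ac) cd)
    -- Since μ is positive, a path of length two through `m` links the ends.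
    ... | no a≢c   | no a≁c
      with m , am , cm ← common-neighbour a≢c a≁c =
      joined-trans (joined-swap (joined-star ab am))
        (joined-trans (joined-swap (joined-star (~-sym am) (~-sym cm))) (joined-star cm cd))

    plus-connected : PlusConnected Γ
    plus-connected (_ , _ , ab) (_ , _ , cd) = Joined.star (all-joined ab cd) forward forward

theorem4p6 : (Γ : Graph 56) → IsSRG Γ 10 0 2 → PlusConnected Γ
theorem4p6 Γ srg = SRG.plus-connected Γ srg refl
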